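{- Let $n$ be a strongly pseudoperfect number. If there exists a strongly pseudoperfect representation of $n$ in which the divisor pair $(1,n)$ is not omitted, then $n^k$ is strongly pseudoperfect for every positive integer $k$.
   Context: A positive integer $n$ is strongly pseudoperfect if there is a subset $S$ of the positive divisors of $n$ (with $1$ and $n$ themselves allowed) such that $d\in S$ if and only if $n/d\in S$ for every positive divisor $d$ of $n$, and $\sum_{d\in S} d = 2n$. Such a set $S$ is called a strongly pseudoperfect representation of $n$. A positive divisor of $n$ that is not in $S$ is called an omitted divisor of the representation; a divisor pair $(d,n/d)$ is omitted if $d,n/d\notin S$. -}

module Defs where

open import Data.List.Base using (List; sum)
open import Data.List.Membership.Propositional using (_∈_; _∉_)
open import Data.List.Relation.Unary.Unique.Propositional using (Unique)
open import Data.Nat.Base using (ℕ; _*_; _<_; _/_; NonZero)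
open import Data.Nat.Divisibility using (_∣_)
open import Data.Product.Base using (_×_; _,_; ∃)
open import Function.Bundles using (_⇔_)
open import Relation.Binary.PropositionalEquality using (_≡_)

-- A finite set of divisors is a duplicate-free list, so that `sum` counts
-- each element once; in particular, when n = d * d the divisor d contributes
-- once, not twice.
record IsRepresentation (n : ℕ) (S : List ℕ) : Set where
  field
    unique    : Unique S
    divisors  : ∀ {d} → d ∈ S → d ∣ n
    symmetric : ∀ d .{{_ : NonZero d}} → d ∣ n → (d ∈ S ⇔ (n / d) ∈ S)
    sum≡2n    : sum S ≡ 2 * n

-- Without 0 < n, zero would qualify, with S = [].
StronglyPseudoperfect : ℕ → Set
StronglyPseudoperfect n = 0 < n × ∃ λ S → IsRepresentation n S

OmittedPair : List ℕ → ℕ × ℕ → Set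
OmittedPair S (d , e) = d ∉ S × e ∉ S

{-# OPTIONS --safe #-}
-- Removing 1 and n from a representation S of n leaves a set M of divisors
-- strictly between 1 and n, closed under d ↦ n / d, with sum n − 1. The blocks
-- nʲ · M for j < k are pairwise disjoint, because nʲ · M lies strictly between
-- nʲ and nʲ⁺¹, and d ↦ nᵏ / d exchanges block j with block k − 1 − j. By a
-- geometric sum their union has sum nᵏ − 1, so adding 1 and nᵏ gives a
-- representation of nᵏ.
module Submission where

open import Data.List.Base using (List; []; _∷_; _++_; map)
open import Data.List.Membership.Propositional using (_∈_)
open import Data.List.Membership.Propositional.Properties
  using (∈-map⁺; ∈-map⁻; ∈-++⁺ˡ; ∈-++⁺ʳ; ∈-++⁻; ∈-∃++)
open import Data.List.Relation.Binary.Permutation.Propositional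
  using (_↭_; ↭-reflexive; ↭-sym; ↭-trans; ↭⇒↭ₛ; prep)
open import Data.List.Relation.Binary.Permutation.Propositional.Properties
  using (∈-resp-↭; shift)
import Data.List.Relation.Binary.Permutation.Setoid.Properties as Permutation
open import Data.List.Relation.Unary.All using ([]; _∷_)
import Data.List.Relation.Unary.All as All
open import Data.List.Relation.Unary.AllPairs using ([]; _∷_)
open import Data.List.Relation.Unary.Any using (here; there)
open import Data.List.Relation.Unary.Unique.Propositional using (Unique)
import Data.List.Relation.Unary.Unique.Propositional.Properties as Unique
open import Data.Nat.Base
open import Data.Nat.Divisibility
  using (_∣_; divides; ∣1⇒≡1; ∣⇒≤; 0∣⇒≡0; m∣m*n)
open import Data.Nat.DivMod using (m*n/n≡m; m*[n/m]≡n)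
open import Data.Nat.ListAction using (sum)
open import Data.Nat.ListAction.Properties using (sum-++; sum-↭)
open import Data.Nat.Properties
open import Data.Nat.Solver using (module +-*-Solver)
open import Data.List.Membership.DecPropositional _≟_ using (_∈?_)
open import Data.Product.Base using (_×_; _,_; ∃; ∃₂)
open import Data.Sum.Base using (_⊎_; inj₁; inj₂)
open import Function.Base using (_∘_)
open import Function.Bundles using (mk⇔; module Equivalence)
open import Relation.Binary.PropositionalEquality
open import Relation.Nullary.Decidable using (yes; no)
open import Relation.Nullary.Negation using (¬_; contradiction)
open import Defs

sum-map-* : ∀ c xs → sum (map (c *_) xs) ≡ c * sum xs
sum-map-* c []       = sym (*-zeroʳ c)
sum-map-* c (x ∷ xs) =
  trans (cong (c * x +_) (sum-map-* c xs)) (sym (*-distribˡ-+ c x (sum xs)))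

∈⇒↭∷ : ∀ {a} {A : Set a} {x : A} {xs} → x ∈ xs → ∃ λ ys → xs ↭ x ∷ ys
∈⇒↭∷ {x = x} x∈xs with ys , zs , eq ← ∈-∃++ x∈xs =
  ys ++ zs , ↭-trans (↭-reflexive eq) (shift x ys zs)

Unique-resp-↭ : ∀ {xs ys : List ℕ} → xs ↭ ys → Unique xs → Unique ys
Unique-resp-↭ = Permutation.Unique-resp-↭ (setoid ℕ) ∘ ↭⇒↭ₛ

-- A division-free form of symmetry: the partner of `d` is any `e` with `d * e ≡ n`, so no nonzero
-- instance is carried along. One implication suffices because multiplication is commutative.
CodivisorClosed : ℕ → List ℕ → Set
CodivisorClosed n S = ∀ {d e} → d ∈ S → d * e ≡ n → e ∈ S

module _ {n} .{{_ : NonZero n}} {S : List ℕ} where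

  symmetric⇒codivisorClosed :
    (∀ d .{{_ : NonZero d}} → d ∣ n → d ∈ S → n / d ∈ S) → CodivisorClosed n S
  symmetric⇒codivisorClosed sm {zero} d∈S refl = contradiction refl (≢-nonZero⁻¹ n)
  symmetric⇒codivisorClosed sm {d@(suc _)} {e} d∈S refl =
    subst (_∈ S) (trans (cong (_/ d) (*-comm d e)) (m*n/n≡m e d)) (sm d (m∣m*n e) d∈S)

  codivisorClosed⇒representation :
    Unique S → (∀ {d} → d ∈ S → d ∣ n) → CodivisorClosed n S → sum S ≡ 2 * n →
    IsRepresentation n S
  codivisorClosed⇒representation u div closed s = record
    { unique    = u
    ; divisors  = div
    ; symmetric = λ d d∣n → mk⇔
        (λ d∈S → closed d∈S (m*[n/m]≡n d∣n))
        (λ q∈S → closed q∈S (trans (*-comm (n / d) d) (m*[n/m]≡n d∣n)))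
    ; sum≡2n    = s
    }

record IsCore (n : ℕ) (M : List ℕ) : Set where
  field
    1<n       : 1 < n
    unique    : Unique M
    1<        : ∀ {d} → d ∈ M → 1 < d
    <n        : ∀ {d} → d ∈ M → d < n
    divisors  : ∀ {d} → d ∈ M → d ∣ n
    closed    : CodivisorClosed n M
    1+sum     : suc (sum M) ≡ n

-- The base case holds the divisor 1, so that the total is exactly `n ^ k` and the geometric sum
-- needs no subtraction: block `k` adds n^k (n - 1), the gap from n^k to n^(k+1).
blocks : ℕ → List ℕ → ℕ → List ℕ
blocks n M zero    = 1 ∷ []
blocks n M (suc k) = map (n ^ k *_) M ++ blocks n M k

module _ {n M} .{{_ : NonZero n}} (core : IsCore n M) where
  open IsCore core

  sum-blocks : ∀ k → sum (blocks n M k) ≡ n ^ k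
  sum-blocks zero    = refl
  sum-blocks (suc k) = begin
    sum (map (n ^ k *_) M ++ blocks n M k)       ≡⟨ sum-++ (map (n ^ k *_) M) _ ⟩
    sum (map (n ^ k *_) M) + sum (blocks n M k)  ≡⟨ cong₂ _+_ (sum-map-* (n ^ k) M) (sum-blocks k) ⟩
    n ^ k * sum M + n ^ k                        ≡⟨ +-comm _ (n ^ k) ⟩
    n ^ k + n ^ k * sum M                        ≡⟨ *-suc (n ^ k) (sum M) ⟨
    n ^ k * suc (sum M)                          ≡⟨ cong (n ^ k *_) 1+sum ⟩
    n ^ k * n                                    ≡⟨ *-comm (n ^ k) n ⟩
    n ^ suc k                                    ∎
    where open ≡-Reasoning

  ∈-blocks⁻ : ∀ k {x} → x ∈ blocks n M k →
              x ≡ 1 ⊎ ∃₂ λ j d → j < k × d ∈ M × x ≡ n ^ j * d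
  ∈-blocks⁻ zero    (here x≡1) = inj₁ x≡1
  ∈-blocks⁻ (suc k) x∈ with ∈-++⁻ (map (n ^ k *_) M) x∈
  ... | inj₁ x∈map with d , d∈M , eq ← ∈-map⁻ (n ^ k *_) x∈map =
    inj₂ (k , d , ≤-refl , d∈M , eq)
  ... | inj₂ x∈rest with ∈-blocks⁻ k x∈rest
  ...   | inj₁ x≡1                      = inj₁ x≡1
  ...   | inj₂ (j , d , j<k , d∈M , eq) = inj₂ (j , d , m<n⇒m<1+n j<k , d∈M , eq)

  1∈blocks : ∀ k → 1 ∈ blocks n M k
  1∈blocks zero    = here refl
  1∈blocks (suc k) = ∈-++⁺ʳ (map (n ^ k *_) M) (1∈blocks k)

  -- The order `<′` is used because its constructors match the recursion of `blocks`: either the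
  -- block on top is meant, or an earlier one.
  ∈-blocks⁺ : ∀ {j k d} → j <′ k → d ∈ M → n ^ j * d ∈ blocks n M k
  ∈-blocks⁺ {k = suc k} ≤′-refl       d∈M = ∈-++⁺ˡ (∈-map⁺ (n ^ k *_) d∈M)
  ∈-blocks⁺ {k = suc k} (≤′-step j<k) d∈M =
    ∈-++⁺ʳ (map (n ^ k *_) M) (∈-blocks⁺ j<k d∈M)

  block-< : ∀ {j k d} → j < k → d ∈ M → n ^ j * d < n ^ k
  block-< {j} {k} {d} j<k d∈M = begin-strict
    n ^ j * d  <⟨ *-monoʳ-< (n ^ j) {{m^n≢0 n j}} (<n d∈M) ⟩
    n ^ j * n  ≡⟨ *-comm (n ^ j) n ⟩
    n ^ suc j  ≤⟨ ^-monoʳ-≤ n j<k ⟩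
    n ^ k      ∎
    where open ≤-Reasoning

  blocks-≤ : ∀ k {x} → x ∈ blocks n M k → x ≤ n ^ k
  blocks-≤ k x∈ with ∈-blocks⁻ k x∈
  ... | inj₁ refl                       = m^n>0 n k
  ... | inj₂ (j , d , j<k , d∈M , refl) = <⇒≤ (block-< j<k d∈M)

  blocks-unique : ∀ k → Unique (blocks n M k)
  blocks-unique zero    = [] ∷ []
  blocks-unique (suc k) =
    Unique.++⁺ (Unique.map⁺ (*-cancelˡ-≡ _ _ (n ^ k) {{m^n≢0 n k}}) unique) (blocks-unique k)
      disjoint
    where
    disjoint : ∀ {x} → ¬ (x ∈ map (n ^ k *_) M × x ∈ blocks n M k)
    disjoint (x∈map , x∈rest) with d , d∈M , refl ← ∈-map⁻ (n ^ k *_) x∈map =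
      -- Since `d` exceeds 1, entries of the new block exceed `n ^ k`, which bounds all earlier
      -- entries.
      <⇒≱ (m<m*n (n ^ k) d {{m^n≢0 n k}} (1< d∈M)) (blocks-≤ k x∈rest)

  codivisor-of-block : ∀ {d e} j i → d * e ≡ n →
                       (n ^ j * d) * (n ^ i * e) ≡ n ^ suc (j + i)
  codivisor-of-block {d} {e} j i refl = begin
    (n ^ j * d) * (n ^ i * e)  ≡⟨ interchange (n ^ j) d (n ^ i) e ⟩
    n * (n ^ j * n ^ i)        ≡⟨ cong (n *_) (^-distribˡ-+-* n j i) ⟨
    n ^ suc (j + i)            ∎
    where
    open ≡-Reasoning
    open +-*-Solver
    interchange : ∀ a b c d → (a * b) * (c * d) ≡ (b * d) * (a * c)
    interchange = solve 4 (λ a b c d → (a :* b) :* (c :* d) := (b :* d) :* (a :* c)) refl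

  codivisor-block : ∀ {k j d} → j < k → d ∈ M →
                    ∃₂ λ i e → i < k × e ∈ M × (n ^ j * d) * (n ^ i * e) ≡ n ^ k
  codivisor-block {j = j} {d} j<k d∈M
    -- As `j < k` means `suc j ≤ k`, this yields `suc j + i ≡ k`, so i = k - 1 - j is the index of
    -- the mirrored block.
    with i , refl ← m≤n⇒∃[o]m+o≡n j<k | divides e n≡e*d ← divisors d∈M =
    i , e , s≤s (m≤n+m i _) , closed d∈M de≡n , codivisor-of-block {d} {e} j i de≡n
    where
    de≡n : d * e ≡ n
    de≡n = trans (*-comm d e) (sym n≡e*d)

  core⇒representation : ∀ k → 0 < k → IsRepresentation (n ^ k) (n ^ k ∷ blocks n M k)
  core⇒representation k 0<k = codivisorClosed⇒representation {{m^n≢0 n k}}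
    (All.tabulate (λ x∈ eq → n^k∉blocks (subst (_∈ blocks n M k) (sym eq) x∈)) ∷ blocks-unique k)
    (λ d∈ → let (e , eq , _) = codivisor d∈ in subst (_ ∣_) eq (m∣m*n e))
    closed′
    (cong (n ^ k +_) (trans (sum-blocks k) (sym (+-identityʳ (n ^ k)))))
    where
    n^k∉blocks : ¬ n ^ k ∈ blocks n M k
    n^k∉blocks n^k∈ with ∈-blocks⁻ k n^k∈
    -- Here `0 < k` matters: for `k` equal to 0 the two added divisors 1 and `n ^ k` would coincide.
    ... | inj₁ n^k≡1                    = <⇒≢ (^-monoʳ-< n 1<n 0<k) (sym n^k≡1)
    ... | inj₂ (j , d , j<k , d∈M , eq) = <⇒≢ (block-< j<k d∈M) (sym eq)

    -- One explicit partner for each entry gives divisibility at once, and closure too, since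
    -- cancellation makes the partner unique.
    codivisor : ∀ {x} → x ∈ n ^ k ∷ blocks n M k →
                ∃ λ y → x * y ≡ n ^ k × y ∈ n ^ k ∷ blocks n M k
    codivisor (here refl) = 1 , *-identityʳ _ , there (1∈blocks k)
    codivisor (there x∈) with ∈-blocks⁻ k x∈
    ... | inj₁ refl = n ^ k , *-identityˡ _ , here refl
    ... | inj₂ (j , d , j<k , d∈M , refl)
      with i , e , i<k , e∈M , eq ← codivisor-block j<k d∈M =
      n ^ i * e , eq , there (∈-blocks⁺ (<⇒<′ i<k) e∈M)

    closed′ : CodivisorClosed (n ^ k) (n ^ k ∷ blocks n M k)
    closed′ {zero}  _  0≡n^k = contradiction (sym 0≡n^k) (≢-nonZero⁻¹ (n ^ k) {{m^n≢0 n k}})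
    closed′ {x@(suc _)} {y} x∈ xy≡n^k with z , xz≡n^k , z∈ ← codivisor x∈ =
      subst (_∈ _) (*-cancelˡ-≡ z y x (trans xz≡n^k (sym xy≡n^k))) z∈

-- The only divisor of 1 is 1, so a duplicate-free list of divisors of 1 cannot reach the sum 2.
1≢n : ∀ {n S} → IsRepresentation n S → 1 ∈ S → 1 ≢ n
1≢n {S = S} rep 1∈S refl with ∈⇒↭∷ 1∈S
... | []    , S↭ with () ← trans (sym (sum-↭ S↭)) (IsRepresentation.sum≡2n rep)
... | x ∷ R , S↭ with (1≢x ∷ _) ∷ _ ← Unique-resp-↭ S↭ (IsRepresentation.unique rep) =
  1≢x (sym (∣1⇒≡1 (IsRepresentation.divisors rep (∈-resp-↭ (↭-sym S↭) (there (here refl))))))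

module _ {n S} .{{_ : NonZero n}} (rep : IsRepresentation n S) where
  open IsRepresentation rep

  representation-closed : CodivisorClosed n S
  representation-closed =
    symmetric⇒codivisorClosed λ d d∣n → Equivalence.to (symmetric d d∣n)

  -- By symmetry, a missing 1 forces a missing `n`, hence an omitted pair. Decidable membership
  -- turns this into a positive statement.
  ¬omitted⇒1∈S : ¬ OmittedPair S (1 , n) → 1 ∈ S
  ¬omitted⇒1∈S ¬om with 1 ∈? S
  ... | yes 1∈S = 1∈S
  ... | no  1∉S = contradiction
    (1∉S , λ n∈S → 1∉S (representation-closed n∈S (*-identityʳ n))) ¬om

  representation⇒core : 1 ∈ S → ∃ (IsCore n)
  representation⇒core 1∈S
    with T , S↭1∷T ← ∈⇒↭∷ 1∈S
    -- As the partner of 1, `n` lies in `S`; being different from 1, it survives in `T` and can be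
    -- removed next.
    with ∈-resp-↭ S↭1∷T (representation-closed 1∈S (*-identityˡ n))
  ... | here n≡1 = contradiction (sym n≡1) (1≢n rep 1∈S)
  ... | there n∈T
    with M , T↭n∷M ← ∈⇒↭∷ n∈T
    with S↭1∷n∷M ← ↭-trans S↭1∷T (prep 1 T↭n∷M)
    -- That 1 and `n` do not recur in `M` is what makes the bounds `1<` and `<n` strict.
    with (1≢n ∷ 1∉M) ∷ n∉M ∷ uniqueM ← Unique-resp-↭ S↭1∷n∷M unique = M , record
    { 1<n      = ≤∧≢⇒< (>-nonZero⁻¹ n) 1≢n
    ; unique   = uniqueM
    ; 1<       = λ d∈M → ≤∧≢⇒< (n≢0⇒n>0 λ d≡0 →
                   ≢-nonZero⁻¹ n (0∣⇒≡0 (subst (_∣ n) d≡0 (divisors (M⊆S d∈M)))))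
                   (All.lookup 1∉M d∈M)
    ; <n       = λ d∈M → ≤∧≢⇒< (∣⇒≤ (divisors (M⊆S d∈M))) (≢-sym (All.lookup n∉M d∈M))
    ; divisors = divisors ∘ M⊆S
    ; closed   = closed
    ; 1+sum    = +-cancelˡ-≡ n _ _ (begin
        n + suc (sum M)       ≡⟨ +-suc n (sum M) ⟩
        sum (1 ∷ n ∷ M)       ≡⟨ sum-↭ S↭1∷n∷M ⟨
        sum S                 ≡⟨ sum≡2n ⟩
        n + (n + 0)           ≡⟨ cong (n +_) (+-identityʳ n) ⟩
        n + n                 ∎)
    }
    where
    open ≡-Reasoning
    M⊆S : ∀ {d} → d ∈ M → d ∈ S
    M⊆S d∈M = ∈-resp-↭ (↭-sym S↭1∷n∷M) (there (there d∈M))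

    closed : CodivisorClosed n M
    closed {d} {e} d∈M de≡n
      -- The partner `e` could leave `M` only as 1 or `n`; then `d` would be `n` or 1, both already
      -- removed.
      with ∈-resp-↭ S↭1∷n∷M (representation-closed (M⊆S d∈M) de≡n)
    ... | there (there e∈M) = e∈M
    ... | here refl = contradiction
      (trans (sym de≡n) (*-identityʳ d)) (All.lookup n∉M d∈M)
    ... | there (here refl) = contradiction
      (*-cancelʳ-≡ 1 d n (trans (*-identityˡ n) (sym de≡n))) (All.lookup 1∉M d∈M)

theorem5 : ∀ (n : ℕ) → StronglyPseudoperfect n →
    (∃ λ S → IsRepresentation n S × ¬ OmittedPair S (1 , n)) →
    ∀ (k : ℕ) → 0 < k → StronglyPseudoperfect (n ^ k)
theorem5 n (0<n , _) (S , rep , ¬om) k 0<k =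
  let instance n≢0 = >-nonZero 0<n
      (M , core) = representation⇒core rep (¬omitted⇒1∈S rep ¬om)
  in m^n>0 n k , n ^ k ∷ blocks n M k , core⇒representation core k 0<k
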